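{- For all integers $n\ge0$ and $k\ge0$ and each $r\in\{1,2,3,4,5,6\}$, we have \[ \mathcal{EO}_u\left(2\times 7^{2k+2}n+2\times 7^{2k+1}r+\frac{7^{2k+2}-1}{6}\right)\equiv 0 \pmod{16}. \]
   Context: For a positive integer $k$, let $f_k:=(q^k;q^k)_\infty=\prod_{i=1}^\infty(1-q^{ki})$. The integers $\mathcal{EO}_u(n)$, $n\ge 0$, are defined by $\sum_{n=0}^\infty \mathcal{EO}_u(n)q^n=\dfrac{f_4^2}{f_2^2}$. -}

module Defs where

open import Data.Bool using (if_then_else_)
open import Data.Fin using (toℕ)
open import Data.Integer using (ℤ; 0ℤ; 1ℤ; _+_; _*_; _-_; -_)
open import Data.Integer.Properties
  using (+-*-semiring; +-identityˡ; +-identityʳ; *-identityʳ; *-zeroʳ; +-comm; +-assoc; +-inverseˡ)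
open import Data.Nat as ℕ using (ℕ; zero; suc; NonZero; z≤n; s≤s; _≤_; _∸_; _≡ᵇ_)
import Data.Nat.Properties as ℕ
open import Function using (_∘_)
open import Relation.Binary.PropositionalEquality
open import Relation.Nullary.Decidable using (dec-false)
open import Algebra.Properties.Semiring.Sum +-*-semiring using (sum⁺-syntax)

-- Formal power series in q over ℤ; `a n` is the coefficient of qⁿ.
PowerSeries : Set
PowerSeries = ℕ → ℤ

infixl 7 _⊛_ _⊘_
infix 8 q^_ 1-q^_ _²

q^_ : ℕ → PowerSeries
(q^ m) n = if m ≡ᵇ n then 1ℤ else 0ℤ

1-q^_ : ℕ → PowerSeries
(1-q^ m) n = (q^ 0) n - (q^ m) n

_⊛_ : PowerSeries → PowerSeries → PowerSeries
(a ⊛ b) n = ∑[ i ≤ n ] (a (toℕ i) * b (n ∸ toℕ i))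

_² : PowerSeries → PowerSeries
a ² = a ⊛ a

-- Long division: c / a = c₀ + q · ((c - c₀ a) / q) / a.  It is the quotient
-- when a has constant term 1 (see ⊘-⊛), and a junk value otherwise.
_⊘_ : PowerSeries → PowerSeries → PowerSeries
(c ⊘ a) zero    = c 0
(c ⊘ a) (suc n) = ((λ m → c (suc m) - c 0 * a (suc m)) ⊘ a) n

-- ∏_{i=1}^{N} (1 - q^{ki})
partialProduct : ℕ → ℕ → PowerSeries
partialProduct k zero    = q^ 0
partialProduct k (suc N) = partialProduct k N ⊛ 1-q^ (k ℕ.* suc N)

-- The infinite product (q^k;q^k)_∞.  Factors with i > n do not affect the
-- coefficient of qⁿ, so the partial product up to i = n already has the
-- limiting coefficient (see f-limit).
f : (k : ℕ) .{{_ : NonZero k}} → PowerSeries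
f k n = partialProduct k n n

EOᵤ : PowerSeries
EOᵤ = f 4 ² ⊘ f 2 ²

-- Correctness of the encodings of the infinite product and the quotient.

⊛-identityʳ-upTo : ∀ a b n → (∀ j → j ≤ n → b j ≡ (q^ 0) j) → (a ⊛ b) n ≡ a n
⊛-identityʳ-upTo a b zero    b≡1 rewrite b≡1 0 z≤n =
  trans (+-identityʳ _) (*-identityʳ (a 0))
⊛-identityʳ-upTo a b (suc n) b≡1 rewrite b≡1 (suc n) ℕ.≤-refl | *-zeroʳ (a 0) =
  trans (+-identityˡ _)
    (⊛-identityʳ-upTo (a ∘ suc) b n (λ j j≤n → b≡1 j (ℕ.m≤n⇒m≤1+n j≤n)))

1-q^-low : ∀ m j → j ℕ.< m → (1-q^ m) j ≡ (q^ 0) j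
1-q^-low m j j<m
  rewrite dec-false (m ℕ.≟ j) (λ m≡j → ℕ.<⇒≢ j<m (sym m≡j)) = +-identityʳ _

partialProduct-stable : ∀ k .{{_ : NonZero k}} n N → n ≤ N →
                        partialProduct k (suc N) n ≡ partialProduct k N n
partialProduct-stable k n N n≤N =
  ⊛-identityʳ-upTo (partialProduct k N) _ n λ j j≤n →
    1-q^-low _ j (ℕ.≤-trans (s≤s (ℕ.≤-trans j≤n n≤N)) (ℕ.m≤n*m (suc N) k))

f-limit : ∀ k .{{_ : NonZero k}} n d → partialProduct k (d ℕ.+ n) n ≡ f k n
f-limit k n zero    = refl
f-limit k n (suc d) =
  trans (partialProduct-stable k n (d ℕ.+ n) (ℕ.m≤n+m n d)) (f-limit k n d)

⊘-⊛ : ∀ c a → a 0 ≡ 1ℤ → (c ⊘ a) ⊛ a ≗ c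
⊘-⊛ c a a₀≡1 zero    rewrite a₀≡1 = trans (+-identityʳ _) (*-identityʳ (c 0))
⊘-⊛ c a a₀≡1 (suc n) = begin
  x + ((c′ ⊘ a) ⊛ a) n        ≡⟨ cong (x +_) (⊘-⊛ c′ a a₀≡1 n) ⟩
  x + (c (suc n) - x)         ≡⟨ +-comm x _ ⟩
  c (suc n) - x + x           ≡⟨ +-assoc (c (suc n)) _ x ⟩
  c (suc n) + (- x + x)       ≡⟨ cong (c (suc n) +_) (+-inverseˡ x) ⟩
  c (suc n) + 0ℤ              ≡⟨ +-identityʳ _ ⟩
  c (suc n)                   ∎
  where
  open ≡-Reasoning
  x  = c 0 * a (suc n)
  c′ : PowerSeries
  c′ m = c (suc m) - c 0 * a (suc m)

EOᵤ-generatingFunction : EOᵤ ⊛ f 2 ² ≗ f 4 ²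
EOᵤ-generatingFunction = ⊘-⊛ (f 4 ²) (f 2 ²) refl

{-# OPTIONS --safe #-}
module Submission where

-- Write P = ∏(1 - q²ⁱ) and R = ∏(1 - q⁴ⁱ), so that EOᵤ = R²/P².  With y = q²ⁱ,
-- ((1 + y)/(1 - y))² = 1 + 4y/(1 - y)², hence R² ≡ P⁴ (1 + 4 V) modulo 16, where
-- V = ∑ y/(1 - y)².  The Lambert rearrangement V = ∑ i y/(1 - y) identifies 4 P² V with
-- -θ(P²) for θ = q d/dq, so EOᵤ ≡ P² - θ(P²): modulo 16 the coefficient EOᵤ(N) is
-- (1 - N) times that of P².  By the pentagonal number theorem P lives on exponents i for
-- which 12i + 1 is a square, so the N-th coefficient of P² can only be nonzero when
-- 12N + 2 is a sum of two squares; here 7 divides 12N + 2 to an odd power.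

open import Algebra.Bundles using (CommutativeRing)
open import Algebra.Solver.Ring.AlmostCommutativeRing using (_-Raw-AlmostCommutative⟶_; fromCommutativeRing)
import Algebra.Solver.Ring as RingSolver
open import Data.Integer as ℤ using (ℤ; +_; 0ℤ; 1ℤ)
import Data.Integer.Properties as ℤ
import Data.Integer.Tactic.RingSolver as ℤRing
open import Data.Maybe using (Maybe; just; nothing)
open import Data.Nat as ℕ using (ℕ; zero; suc; _<_; s≤s; z≤n)
import Data.Nat.Properties as ℕ
import Data.Nat.Tactic.RingSolver as ℕRing
open import Data.Product using (_×_; _,_; ∃-syntax)
open import Function using (_∘_)
open import Relation.Binary.PropositionalEquality as ≡ using (_≡_)
open import Relation.Nullary using (¬_; yes; no)

tri : ℕ → ℕ
tri zero    = 0
tri (suc n) = tri n ℕ.+ suc n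

-- Finite sums and products in a commutative ring.

module RingIdentities {c ℓ} (R : CommutativeRing c ℓ)
  (ι-morphism : ℤ.+-*-rawRing -Raw-AlmostCommutative⟶ fromCommutativeRing R) where

  open CommutativeRing R hiding (zero)
  open _-Raw-AlmostCommutative⟶_ ι-morphism public using ()
    renaming (⟦_⟧ to ι; +-homo to ι-+)

  private
    _ι≟_ : ∀ a b → Maybe (ι a ≈ ι b)
    a ι≟ b with a ℤ.≟ b
    ... | yes ≡.refl = just refl
    ... | no  _      = nothing

  open RingSolver ℤ.+-*-rawRing (fromCommutativeRing R) ι-morphism _ι≟_ public
    using (solve; _:=_; _:+_; _:*_; _:-_; :-_; con)

  -- Empty sums and products are images under `ι` rather than the ring's own constants, so that they
  -- match `con` in the solver.
  ∑₁ ∏₁ : ℕ → (ℕ → Carrier) → Carrier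
  ∑₁ zero    g = ι 0ℤ
  ∑₁ (suc n) g = ∑₁ n g + g (suc n)
  ∏₁ zero    g = ι 1ℤ
  ∏₁ (suc n) g = ∏₁ n g * g (suc n)

  ∑₁-cong : ∀ n {g h} → (∀ i → g (suc i) ≈ h (suc i)) → ∑₁ n g ≈ ∑₁ n h
  ∑₁-cong zero    g≈h = refl
  ∑₁-cong (suc n) g≈h = +-cong (∑₁-cong n g≈h) (g≈h n)

  ∑₁-0 : ∀ n {g} → (∀ i → g (suc i) ≈ ι 0ℤ) → ∑₁ n g ≈ ι 0ℤ
  ∑₁-0 zero    g≈0 = refl
  ∑₁-0 (suc n) g≈0 = trans (+-cong (∑₁-0 n g≈0) (g≈0 n)) (sym (ι-+ 0ℤ 0ℤ))

  ∑₁-+ : ∀ n g h → ∑₁ n (λ i → g i + h i) ≈ ∑₁ n g + ∑₁ n h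
  ∑₁-+ zero    g h = ι-+ 0ℤ 0ℤ
  ∑₁-+ (suc n) g h = trans (+-congʳ (∑₁-+ n g h))
    (solve 4 (λ a b c d → a :+ b :+ (c :+ d) := a :+ c :+ (b :+ d)) refl
      (∑₁ n g) (∑₁ n h) (g (suc n)) (h (suc n)))

  ∑₁-*ˡ : ∀ n c g → ∑₁ n (λ i → c * g i) ≈ c * ∑₁ n g
  ∑₁-*ˡ zero    c g = solve 1 (λ c → con 0ℤ := c :* con 0ℤ) refl c
  ∑₁-*ˡ (suc n) c g = trans (+-congʳ (∑₁-*ˡ n c g)) (sym (distribˡ c _ _))

  ∑₁-comm : ∀ m n (g : ℕ → ℕ → Carrier) → ∑₁ m (λ i → ∑₁ n (g i)) ≈ ∑₁ n (λ j → ∑₁ m (λ i → g i j))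
  ∑₁-comm zero    n g = sym (∑₁-0 n λ _ → refl)
  ∑₁-comm (suc m) n g =
    trans (+-congʳ (∑₁-comm m n g)) (sym (∑₁-+ n (λ j → ∑₁ m (λ i → g i j)) (g (suc m))))

  -- Geometric series and Euler products in a nilpotent x.

  module NilpotentProducts
    (N : ℕ) (x^_ : ℕ → Carrier)
    (x^0 : x^ 0 ≈ ι 1ℤ)
    (x^-+ : ∀ m n → x^ (m ℕ.+ n) ≈ x^ m * x^ n)
    -- Since powers beyond `N` vanish, series and products in x are finite and no limits occur.
    (x^-nilpotent : ∀ n → N < n → x^ n ≈ ι 0ℤ)
    where

    open import Relation.Binary.Reasoning.Setoid setoid

    x^-cong : ∀ {m n} → m ≡ n → x^ m ≈ x^ n
    x^-cong m≡n = reflexive (≡.cong x^_ m≡n)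

    x^[i*suc] : ∀ i m → x^ (i ℕ.* suc m) ≈ x^ i * x^ (i ℕ.* m)
    x^[i*suc] i m = trans (x^-cong (ℕ.*-suc i m)) (x^-+ i (i ℕ.* m))

    ι-suc : ∀ n → ι (+ suc n) ≈ ι 1ℤ + ι (+ n)
    ι-suc n = ι-+ 1ℤ (+ n)

    -- For i > 0 and y = x^ i, nilpotency makes geo i N = y/(1 - y) and wgeo i N = y/(1 - y)².
    geo wgeo : ℕ → ℕ → Carrier
    geo  i M = ∑₁ M (λ m → x^ (i ℕ.* m))
    wgeo i M = ∑₁ M (λ m → ι (+ m) * x^ (i ℕ.* m))

    -- Multiplying by y = `x^ i` moves each exponent up one step; the leading 1 fills the gap at the
    -- bottom and one power is left over at the top.
    geo-shift : ∀ i M → x^ i * (ι 1ℤ + geo i M) ≈ geo i M + x^ (i ℕ.* suc M)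
    geo-shift i zero = begin
      x^ i * (ι 1ℤ + ι 0ℤ)   ≈⟨ solve 1 (λ y → y :* (con 1ℤ :+ con 0ℤ) := con 0ℤ :+ y) refl (x^ i) ⟩
      ι 0ℤ + x^ i            ≈⟨ +-congˡ (x^-cong (ℕ.*-identityʳ i)) ⟨
      ι 0ℤ + x^ (i ℕ.* 1)    ∎
    geo-shift i (suc M) = begin
      x^ i * (ι 1ℤ + (geo i M + x^ (i ℕ.* suc M)))
        ≈⟨ solve 3 (λ y g z → y :* (con 1ℤ :+ (g :+ z)) := y :* (con 1ℤ :+ g) :+ y :* z) refl
             (x^ i) (geo i M) (x^ (i ℕ.* suc M)) ⟩
      x^ i * (ι 1ℤ + geo i M) + x^ i * x^ (i ℕ.* suc M)
        ≈⟨ +-cong (geo-shift i M) (sym (x^[i*suc] i (suc M))) ⟩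
      geo i (suc M) + x^ (i ℕ.* suc (suc M))  ∎

    -- Multiplication by y turns the weight m of yᵐ into m - 1, which a copy of `geo i M` restores;
    -- the extra term on the left matches the overshoot at the top.
    wgeo-shift : ∀ i M → wgeo i M + ι (+ M) * x^ (i ℕ.* suc M) ≈ x^ i * wgeo i M + geo i M
    wgeo-shift i zero =
      solve 2 (λ y z → con 0ℤ :+ con 0ℤ :* z := y :* con 0ℤ :+ con 0ℤ) refl (x^ i) (x^ (i ℕ.* 1))
    wgeo-shift i (suc M) = begin
      (w + ι (+ suc M) * z) + ι (+ suc M) * x^ (i ℕ.* suc (suc M))
        ≈⟨ +-cong (+-congˡ (*-congʳ (ι-suc M))) (*-congˡ (x^[i*suc] i (suc M))) ⟩
      (w + (ι 1ℤ + ι (+ M)) * z) + ι (+ suc M) * (y * z)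
        ≈⟨ solve 5 (λ w m s y z → (w :+ (con 1ℤ :+ m) :* z) :+ s :* (y :* z)
                               := (w :+ m :* z) :+ (z :+ s :* (y :* z))) refl
             w (ι (+ M)) (ι (+ suc M)) y z ⟩
      (w + ι (+ M) * z) + (z + ι (+ suc M) * (y * z))
        ≈⟨ +-congʳ (wgeo-shift i M) ⟩
      (y * w + g) + (z + ι (+ suc M) * (y * z))
        ≈⟨ solve 5 (λ w g s y z → (y :* w :+ g) :+ (z :+ s :* (y :* z))
                               := y :* (w :+ s :* z) :+ (g :+ z)) refl
             w g (ι (+ suc M)) y z ⟩
      y * (w + ι (+ suc M) * z) + (g + z)  ∎
      where
      w = wgeo i M
      g = geo i M
      y = x^ i
      z = x^ (i ℕ.* suc M)

    factor geoInv : ℕ → Carrier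
    factor i = ι 1ℤ - x^ i
    geoInv i = ι 1ℤ + geo i N

    -- This removes the left-over top terms of both shift lemmas. The base index has to be positive,
    -- because `x^ 0` is 1.
    x^[suci*sucN] : ∀ i → x^ (suc i ℕ.* suc N) ≈ ι 0ℤ
    x^[suci*sucN] i = x^-nilpotent _ (ℕ.m≤n*m (suc N) (suc i))

    x^*geoInv : ∀ i → x^ (suc i) * geoInv (suc i) ≈ geo (suc i) N
    x^*geoInv i = begin
      x^ (suc i) * geoInv (suc i)                ≈⟨ geo-shift (suc i) N ⟩
      geo (suc i) N + x^ (suc i ℕ.* suc N)       ≈⟨ +-congˡ (x^[suci*sucN] i) ⟩
      geo (suc i) N + ι 0ℤ                       ≈⟨ solve 1 (λ g → g :+ con 0ℤ := g) refl _ ⟩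
      geo (suc i) N                              ∎

    factor*geoInv : ∀ i → factor (suc i) * geoInv (suc i) ≈ ι 1ℤ
    factor*geoInv i = begin
      (ι 1ℤ - y) * (ι 1ℤ + g)
        ≈⟨ solve 2 (λ y g → (con 1ℤ :- y) :* (con 1ℤ :+ g) := con 1ℤ :+ g :- y :* (con 1ℤ :+ g)) refl y g ⟩
      ι 1ℤ + g - y * (ι 1ℤ + g)
        ≈⟨ +-congˡ (-‿cong (x^*geoInv i)) ⟩
      ι 1ℤ + g - g
        ≈⟨ solve 1 (λ g → con 1ℤ :+ g :- g := con 1ℤ) refl g ⟩
      ι 1ℤ  ∎
      where
      y = x^ (suc i)
      g = geo (suc i) N

    factor*geo : ∀ i → factor (suc i) * geo (suc i) N ≈ x^ (suc i)
    factor*geo i = begin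
      (ι 1ℤ - y) * g
        ≈⟨ solve 2 (λ y g → (con 1ℤ :- y) :* g := (con 1ℤ :- y) :* (con 1ℤ :+ g) :+ (y :- con 1ℤ)) refl y g ⟩
      (ι 1ℤ - y) * (ι 1ℤ + g) + (y - ι 1ℤ)
        ≈⟨ +-congʳ (factor*geoInv i) ⟩
      ι 1ℤ + (y - ι 1ℤ)
        ≈⟨ solve 1 (λ y → con 1ℤ :+ (y :- con 1ℤ) := y) refl y ⟩
      y ∎
      where
      y = x^ (suc i)
      g = geo (suc i) N

    factor*wgeo : ∀ i → factor (suc i) * wgeo (suc i) N ≈ geo (suc i) N
    factor*wgeo i = begin
      (ι 1ℤ - y) * w
        -- The summand `n :* con 0ℤ` is inserted to become the vanishing top term of `wgeo-shift`.
        ≈⟨ solve 3 (λ y w n → (con 1ℤ :- y) :* w := w :+ n :* con 0ℤ :- y :* w) refl y w (ι (+ N)) ⟩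
      w + ι (+ N) * ι 0ℤ - y * w
        ≈⟨ +-congʳ (+-congˡ (*-congˡ (x^[suci*sucN] i))) ⟨
      w + ι (+ N) * x^ (suc i ℕ.* suc N) - y * w
        ≈⟨ +-congʳ (wgeo-shift (suc i) N) ⟩
      y * w + g - y * w
        ≈⟨ solve 3 (λ y w g → y :* w :+ g :- y :* w := g) refl y w g ⟩
      g ∎
      where
      y = x^ (suc i)
      w = wgeo (suc i) N
      g = geo (suc i) N

    -- With x = q² and n = `N`, the first three are f₂, f₄ and 1/f₂ up to the truncation degree.
    P R₂ P⁻¹ V : ℕ → Carrier
    P   n = ∏₁ n factor
    R₂  n = ∏₁ n (λ i → factor (2 ℕ.* i))
    P⁻¹ n = ∏₁ n geoInv
    V   n = ∑₁ n (λ i → wgeo i N)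

    P*P⁻¹ : ∀ n → P n * P⁻¹ n ≈ ι 1ℤ
    P*P⁻¹ zero    = solve 0 (con 1ℤ :* con 1ℤ := con 1ℤ) refl
    P*P⁻¹ (suc n) = begin
      (P n * factor (suc n)) * (P⁻¹ n * geoInv (suc n))
        ≈⟨ solve 4 (λ a b c d → (a :* b) :* (c :* d) := (a :* c) :* (b :* d)) refl
             (P n) (factor (suc n)) (P⁻¹ n) (geoInv (suc n)) ⟩
      (P n * P⁻¹ n) * (factor (suc n) * geoInv (suc n))
        ≈⟨ *-cong (P*P⁻¹ n) (factor*geoInv n) ⟩
      ι 1ℤ * ι 1ℤ
        ≈⟨ solve 0 (con 1ℤ :* con 1ℤ := con 1ℤ) refl ⟩
      ι 1ℤ ∎

    -- ((1 + y) / (1 - y))² = 1 + 4y / (1 - y)²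
    factor-double² : ∀ i → let a = factor (suc i) ; b = factor (2 ℕ.* suc i) in
      b * b ≈ (a * a) * (a * a) * (ι 1ℤ + ι (+ 4) * wgeo (suc i) N)
    factor-double² i = sym (begin
      (a * a) * (a * a) * (ι 1ℤ + ι (+ 4) * w)
        ≈⟨ solve 2 (λ a w → (a :* a) :* (a :* a) :* (con 1ℤ :+ con (+ 4) :* w)
                         := (a :* a) :* (a :* a :+ con (+ 4) :* (a :* (a :* w)))) refl a w ⟩
      (a * a) * (a * a + ι (+ 4) * (a * (a * w)))
        ≈⟨ *-congˡ (+-congˡ (*-congˡ (trans (*-congˡ (factor*wgeo i)) (factor*geo i)))) ⟩
      (a * a) * (a * a + ι (+ 4) * y)
        ≈⟨ solve 1 (λ y → let a = con 1ℤ :- y ; b = con 1ℤ :- y :* y in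
                          (a :* a) :* (a :* a :+ con (+ 4) :* y) := b :* b) refl y ⟩
      (ι 1ℤ - y * y) * (ι 1ℤ - y * y)
        ≈⟨ *-cong eq eq ⟩
      factor (2 ℕ.* suc i) * factor (2 ℕ.* suc i) ∎)
      where
      y = x^ (suc i)
      a = factor (suc i)
      w = wgeo (suc i) N
      eq : ι 1ℤ - y * y ≈ factor (2 ℕ.* suc i)
      eq = +-congˡ (-‿cong (trans (sym (x^-+ (suc i) (suc i)))
             (x^-cong (≡.cong (suc i ℕ.+_) (≡.sym (ℕ.+-identityʳ (suc i)))))))

    -- In a product of factors 1 + 4w the linear terms add up to 4V, while every cross term of two
    -- or more factors is a multiple of 16.
    R₂²-mod16 : ∀ n → ∃[ c ] R₂ n * R₂ n ≈
      (P n * P n) * (P n * P n) * (ι 1ℤ + ι (+ 4) * V n + ι (+ 16) * c)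
    R₂²-mod16 zero = ι 0ℤ , solve 0 (let e = con 1ℤ in
      e :* e := (e :* e) :* (e :* e) :* (e :+ con (+ 4) :* con 0ℤ :+ con (+ 16) :* con 0ℤ)) refl
    R₂²-mod16 (suc n) with R₂²-mod16 n
    -- The new error collects 4V · 4w = 16 V w and 16c · 4w = 16 · 4cw.
    ... | c , R₂²≈ = c + V n * w + ι (+ 4) * (c * w) , (begin
      (R₂ n * b) * (R₂ n * b)
        ≈⟨ solve 2 (λ r b → (r :* b) :* (r :* b) := (r :* r) :* (b :* b)) refl (R₂ n) b ⟩
      (R₂ n * R₂ n) * (b * b)
        ≈⟨ *-cong R₂²≈ (factor-double² n) ⟩
      ((P n * P n) * (P n * P n) * (ι 1ℤ + ι (+ 4) * V n + ι (+ 16) * c)) *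
      ((a * a) * (a * a) * (ι 1ℤ + ι (+ 4) * w))
        ≈⟨ solve 5 (λ p a v w c →
             ((p :* p) :* (p :* p) :* (con 1ℤ :+ con (+ 4) :* v :+ con (+ 16) :* c)) :*
             ((a :* a) :* (a :* a) :* (con 1ℤ :+ con (+ 4) :* w)) :=
             ((p :* a) :* (p :* a)) :* ((p :* a) :* (p :* a)) :*
             (con 1ℤ :+ con (+ 4) :* (v :+ w) :+ con (+ 16) :* (c :+ v :* w :+ con (+ 4) :* (c :* w))))
             refl (P n) a (V n) w c ⟩
      ((P n * a) * (P n * a)) * ((P n * a) * (P n * a)) *
      (ι 1ℤ + ι (+ 4) * (V n + w) + ι (+ 16) * (c + V n * w + ι (+ 4) * (c * w))) ∎)
      where
      a = factor (suc n)
      b = factor (2 ℕ.* suc n)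
      w = wgeo (suc n) N

    -- Both sides are the double sum of m xⁱᵐ over 1 ≤ i, m ≤ `N`, read by rows and by columns. The
    -- right-hand form is the one that differentiating `P` produces.
    V-lambert : V N ≈ ∑₁ N (λ i → ι (+ i) * geo i N)
    V-lambert = begin
      ∑₁ N (λ i → ∑₁ N (λ m → ι (+ m) * x^ (i ℕ.* m)))
        ≈⟨ ∑₁-comm N N (λ i m → ι (+ m) * x^ (i ℕ.* m)) ⟩
      ∑₁ N (λ m → ∑₁ N (λ i → ι (+ m) * x^ (i ℕ.* m)))
        ≈⟨ ∑₁-cong N (λ m → trans (∑₁-*ˡ N (ι (+ suc m)) (λ i → x^ (i ℕ.* suc m)))
             (*-congˡ (∑₁-cong N (λ i → x^-cong (ℕ.*-comm (suc i) (suc m)))))) ⟩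
      ∑₁ N (λ m → ι (+ m) * geo m N) ∎

    -- The pentagonal number theorem.

    ε : ℕ → Carrier
    ε zero    = ι 1ℤ
    ε (suc n) = - ε n

    -- Shanks's finite form of the pentagonal number theorem: P n times the sum of
    -- (-1)ᵏ x^(kn + k(k+1)/2) / P k over k ≤ n is the truncated pentagonal series pent n.
    -- For n = N only the summand k = 0 survives.
    term : ℕ → ℕ → Carrier
    term n k = ε k * (P⁻¹ k * x^ (k ℕ.* n ℕ.+ tri k))

    shanksSum : ℕ → ℕ → Carrier
    shanksSum n k = ι 1ℤ + ∑₁ k (term n)

    -- The change from level n to n + 1 telescopes in k, so a single boundary term remains.
    shanks-step : ∀ n k → P (suc n) * shanksSum (suc n) k ≈
      P n * shanksSum n k - ε k * (P n * (P⁻¹ k * x^ (suc k ℕ.* suc n ℕ.+ tri k)))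
    shanks-step n zero = begin
      (P n * (ι 1ℤ - x^ suc n)) * (ι 1ℤ + ι 0ℤ)
        ≈⟨ *-congʳ (*-congˡ (+-congˡ (-‿cong (x^-cong
             (≡.sym (≡.trans (ℕ.+-identityʳ _) (ℕ.+-identityʳ (suc n)))))))) ⟩
      (P n * (ι 1ℤ - z)) * (ι 1ℤ + ι 0ℤ)
        ≈⟨ solve 2 (λ p z → let e = con 1ℤ in (p :* (e :- z)) :* (e :+ con 0ℤ)
                         := p :* (e :+ con 0ℤ) :- e :* (p :* (e :* z))) refl (P n) z ⟩
      P n * (ι 1ℤ + ι 0ℤ) - ι 1ℤ * (P n * (ι 1ℤ * z)) ∎
      where z = x^ (1 ℕ.* suc n ℕ.+ 0)
    shanks-step n (suc k) = begin
      (P n * (ι 1ℤ - y)) * (ι 1ℤ + (s′ + (- ε k) * (u * x^ (suc k ℕ.* suc n ℕ.+ tri (suc k)))))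
        ≈⟨ *-congˡ (+-congˡ (+-congˡ (*-congˡ (*-congˡ A′≈)))) ⟩
      (P n * (ι 1ℤ - y)) * (ι 1ℤ + (s′ + (- ε k) * (u * (z * A))))
        ≈⟨ solve 7 (λ p y s e u z A →
             (p :* (con 1ℤ :- y)) :* (con 1ℤ :+ (s :+ (:- e) :* (u :* (z :* A)))) :=
             (p :* (con 1ℤ :- y)) :* (con 1ℤ :+ s) :- e :* (p :* (con 1ℤ :- y) :* (u :* (z :* A))))
             refl (P n) y s′ (ε k) u z A ⟩
      P (suc n) * shanksSum (suc n) k - ε k * (P n * (ι 1ℤ - y) * (u * (z * A)))
        ≈⟨ +-congʳ (shanks-step n k) ⟩
      P n * shanksSum n k - ε k * (P n * (P⁻¹ k * x^ (suc k ℕ.* suc n ℕ.+ tri k)))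
        - ε k * (P n * (ι 1ℤ - y) * (u * (z * A)))
        -- The old boundary term carries the same power `A` as the summand to be added at level n.
        -- Once `P⁻¹ k` is written as `u * (ι 1ℤ - z)`, its z-part cancels against part of the new
        -- summand at level n + 1, and what is left is the next summand and the next boundary term.
        ≈⟨ +-congʳ (+-congˡ (-‿cong (*-congˡ (*-congˡ (*-cong P⁻¹≈ X≈))))) ⟩
      P n * (ι 1ℤ + s) - ε k * (P n * (u * (ι 1ℤ - z) * A)) - ε k * (P n * (ι 1ℤ - y) * (u * (z * A)))
        ≈⟨ solve 7 (λ p y s e u z A →
             p :* (con 1ℤ :+ s) :- e :* (p :* (u :* (con 1ℤ :- z) :* A))
               :- e :* (p :* (con 1ℤ :- y) :* (u :* (z :* A))) :=
             p :* (con 1ℤ :+ (s :+ (:- e) :* (u :* A))) :- (:- e) :* (p :* (u :* (y :* (z :* A)))))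
             refl (P n) y s (ε k) u z A ⟩
      P n * (ι 1ℤ + (s + (- ε k) * (u * A))) - (- ε k) * (P n * (u * (y * (z * A))))
        ≈⟨ +-congˡ (-‿cong (*-congˡ (*-congˡ (*-congˡ
             (trans (*-congˡ (sym A′≈)) (sym B≈)))))) ⟩
      P n * shanksSum n (suc k)
        - ε (suc k) * (P n * (P⁻¹ (suc k) * x^ (suc (suc k) ℕ.* suc n ℕ.+ tri (suc k)))) ∎
      where
      y  = x^ (suc n)
      z  = x^ (suc k)
      A  = x^ (suc k ℕ.* n ℕ.+ tri (suc k))
      u  = P⁻¹ (suc k)
      s  = ∑₁ k (term n)
      s′ = ∑₁ k (term (suc n))
      A′≈ : x^ (suc k ℕ.* suc n ℕ.+ tri (suc k)) ≈ z * A
      A′≈ = trans (x^-cong (≡.trans (≡.cong (ℕ._+ tri (suc k)) (ℕ.*-suc (suc k) n)) (ℕ.+-assoc (suc k) _ _)))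
                  (x^-+ (suc k) _)
      X≈ : x^ (suc k ℕ.* suc n ℕ.+ tri k) ≈ A
      X≈ = x^-cong (exponent k n (tri k))
        where
        exponent : ∀ k n t → suc k ℕ.* suc n ℕ.+ t ≡ suc k ℕ.* n ℕ.+ (t ℕ.+ suc k)
        exponent = ℕRing.solve-∀
      B≈ : x^ (suc (suc k) ℕ.* suc n ℕ.+ tri (suc k)) ≈ y * x^ (suc k ℕ.* suc n ℕ.+ tri (suc k))
      B≈ = trans (x^-cong (ℕ.+-assoc (suc n) _ _)) (x^-+ (suc n) _)
      P⁻¹≈ : P⁻¹ k ≈ u * (ι 1ℤ - z)
      P⁻¹≈ = begin
        P⁻¹ k                                         ≈⟨ solve 1 (λ a → a := a :* con 1ℤ) refl _ ⟩
        P⁻¹ k * ι 1ℤ                                  ≈⟨ *-congˡ (factor*geoInv k) ⟨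
        P⁻¹ k * (factor (suc k) * geoInv (suc k))     ≈⟨ solve 3 (λ a b c → a :* (b :* c) := a :* c :* b) refl
                                                           (P⁻¹ k) (factor (suc k)) (geoInv (suc k)) ⟩
        u * (ι 1ℤ - z) ∎

    -- For m = n + 1 the two exponents are m(3m - 1)/2 and m(3m + 1)/2, the generalised pentagonal
    -- numbers.
    pent : ℕ → Carrier
    pent zero    = ι 1ℤ
    pent (suc n) = pent n + ε (suc n) *
      (x^ (suc n ℕ.* suc n ℕ.+ tri n) + x^ (suc n ℕ.* suc n ℕ.+ tri (suc n)))

    -- The boundary term of `shanks-step n n` and the last summand at level n + 1 are the two new
    -- pentagonal monomials, once `P` cancels `P⁻¹`.
    shanks : ∀ n → P n * shanksSum n n ≈ pent n
    shanks zero    = solve 0 (con 1ℤ :* (con 1ℤ :+ con 0ℤ) := con 1ℤ) refl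
    shanks (suc n) = begin
      p′ * (ι 1ℤ + (s′ + (- ε n) * (u * X₂)))
        ≈⟨ solve 5 (λ p s e u X → p :* (con 1ℤ :+ (s :+ (:- e) :* (u :* X)))
                               := p :* (con 1ℤ :+ s) :+ (:- e) :* ((p :* u) :* X)) refl p′ s′ (ε n) u X₂ ⟩
      p′ * (ι 1ℤ + s′) + (- ε n) * ((p′ * u) * X₂)
        ≈⟨ +-cong (shanks-step n n) (*-congˡ (*-congʳ (P*P⁻¹ (suc n)))) ⟩
      P n * shanksSum n n - ε n * (P n * (P⁻¹ n * X₁)) + (- ε n) * (ι 1ℤ * X₂)
        ≈⟨ solve 6 (λ a e p u X Y → a :- e :* (p :* (u :* X)) :+ (:- e) :* (con 1ℤ :* Y)
                                 := a :+ (:- e) :* ((p :* u) :* X :+ Y)) refl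
             (P n * shanksSum n n) (ε n) (P n) (P⁻¹ n) X₁ X₂ ⟩
      P n * shanksSum n n + (- ε n) * ((P n * P⁻¹ n) * X₁ + X₂)
        ≈⟨ +-cong (shanks n) (*-congˡ (+-congʳ (trans (*-congʳ (P*P⁻¹ n))
             (solve 1 (λ X → con 1ℤ :* X := X) refl X₁)))) ⟩
      pent n + (- ε n) * (X₁ + X₂) ∎
      where
      p′ = P (suc n)
      u  = P⁻¹ (suc n)
      s′ = ∑₁ n (term (suc n))
      X₁ = x^ (suc n ℕ.* suc n ℕ.+ tri n)
      X₂ = x^ (suc n ℕ.* suc n ℕ.+ tri (suc n))

    P≈pent : P N ≈ pent N
    P≈pent = begin
      P N                     ≈⟨ solve 1 (λ p → p := p :* (con 1ℤ :+ con 0ℤ)) refl (P N) ⟩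
      P N * (ι 1ℤ + ι 0ℤ)     ≈⟨ *-congˡ (+-congˡ (∑₁-0 N term≈0)) ⟨
      P N * shanksSum N N     ≈⟨ shanks N ⟩
      pent N                  ∎
      where
      term≈0 : ∀ k → term N (suc k) ≈ ι 0ℤ
      term≈0 k = trans (*-congˡ (*-congˡ (x^-nilpotent _ N<)))
        (solve 2 (λ a b → a :* (b :* con 0ℤ) := con 0ℤ) refl (ε (suc k)) (P⁻¹ (suc k)))
        where
        -- As `tri (suc k)` is at least `suc k`, the exponent is at least `N + suc k`, even for `N`
        -- = 0.
        N< : N < suc k ℕ.* N ℕ.+ tri (suc k)
        N< = ℕ.<-≤-trans (ℕ.m<m+n N (s≤s z≤n))
               (ℕ.+-mono-≤ (ℕ.m≤n*m N (suc k)) (ℕ.m≤n+m (suc k) (tri k)))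

    -- Logarithmic differentiation of the Euler product.

    module _ (D : Carrier → Carrier)
      (D-* : ∀ a b → D (a * b) ≈ D a * b + a * D b)
      (D-1 : D (ι 1ℤ) ≈ ι 0ℤ)
      -- The 2 anticipates x = q²: the operator q d/dq multiplies xⁱ by 2i.
      (D-factor : ∀ i → D (factor i) ≈ - (ι (+ 2) * (ι (+ i) * x^ i)))
      where

      -- The factor 1 - y with y = `x^ i` has logarithmic derivative -2i y/(1 - y). Writing y as (1
      -- - y) · `geo i N` keeps the factor in the product and avoids division.
      D-P : ∀ n → D (P n) ≈ - (ι (+ 2) * (P n * ∑₁ n (λ i → ι (+ i) * geo i N)))
      D-P zero    = trans D-1 (solve 0 (con 0ℤ := :- (con (+ 2) :* (con 1ℤ :* con 0ℤ))) refl)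
      D-P (suc n) = begin
        D (P n * a)
          ≈⟨ D-* (P n) a ⟩
        D (P n) * a + P n * D a
          ≈⟨ +-cong (*-congʳ (D-P n)) (*-congˡ (trans (D-factor (suc n))
               (-‿cong (*-congˡ (*-congˡ (sym (factor*geo n))))))) ⟩
        (- (ι (+ 2) * (P n * L))) * a + P n * (- (ι (+ 2) * (m * (a * g))))
          ≈⟨ solve 5 (λ p a l m g →
               (:- (con (+ 2) :* (p :* l))) :* a :+ p :* (:- (con (+ 2) :* (m :* (a :* g)))) :=
               :- (con (+ 2) :* ((p :* a) :* (l :+ m :* g)))) refl (P n) a L m g ⟩
        - (ι (+ 2) * ((P n * a) * (L + m * g))) ∎
        where
        a = factor (suc n)
        L = ∑₁ n (λ i → ι (+ i) * geo i N)
        m = ι (+ suc n)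
        g = geo (suc n) N

      -- Cancelling `P²` from `P⁴`(1 + 4V + 16c) leaves `P²`(1 + 4V + 16c). Since D P = -2PV, the
      -- Leibniz rule turns 4P²V into -D(P²).
      quotient-mod16 : ∀ e → e * (P N * P N) ≈ R₂ N * R₂ N →
        ∃[ c ] e ≈ P N * P N - D (P N * P N) + ι (+ 16) * c
      quotient-mod16 e e*P²≈R₂² with R₂²-mod16 N
      ... | c , R₂²≈ = p * p * c , (begin
        e
          ≈⟨ solve 1 (λ e → e := e :* (con 1ℤ :* con 1ℤ)) refl e ⟩
        e * (ι 1ℤ * ι 1ℤ)
          ≈⟨ *-congˡ (*-cong (P*P⁻¹ N) (P*P⁻¹ N)) ⟨
        e * ((p * u) * (p * u))
          ≈⟨ solve 3 (λ e p u → e :* ((p :* u) :* (p :* u)) := (e :* (p :* p)) :* (u :* u)) refl e p u ⟩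
        (e * (p * p)) * (u * u)
          ≈⟨ *-congʳ (trans e*P²≈R₂² R₂²≈) ⟩
        ((p * p) * (p * p) * (ι 1ℤ + ι (+ 4) * V N + ι (+ 16) * c)) * (u * u)
          ≈⟨ solve 4 (λ p u v c →
               ((p :* p) :* (p :* p) :* (con 1ℤ :+ con (+ 4) :* v :+ con (+ 16) :* c)) :* (u :* u) :=
               ((p :* u) :* (p :* u)) :* ((p :* p) :* (con 1ℤ :+ con (+ 4) :* v :+ con (+ 16) :* c)))
               refl p u (V N) c ⟩
        ((p * u) * (p * u)) * ((p * p) * (ι 1ℤ + ι (+ 4) * V N + ι (+ 16) * c))
          ≈⟨ *-congʳ (*-cong (P*P⁻¹ N) (P*P⁻¹ N)) ⟩
        (ι 1ℤ * ι 1ℤ) * ((p * p) * (ι 1ℤ + ι (+ 4) * V N + ι (+ 16) * c))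
          ≈⟨ solve 3 (λ p v c → let d = :- (con (+ 2) :* (p :* v)) in
               (con 1ℤ :* con 1ℤ) :* ((p :* p) :* (con 1ℤ :+ con (+ 4) :* v :+ con (+ 16) :* c)) :=
               p :* p :- (d :* p :+ p :* d) :+ con (+ 16) :* (p :* p :* c)) refl p (V N) c ⟩
        p * p - (d * p + p * d) + ι (+ 16) * (p * p * c)
          ≈⟨ +-congʳ (+-congˡ (-‿cong (trans (+-cong (*-congʳ Dp) (*-congˡ Dp)) (sym (D-* p p))))) ⟩
        p * p - D (p * p) + ι (+ 16) * (p * p * c) ∎)
        where
        p = P N
        u = P⁻¹ N
        d = - (ι (+ 2) * (p * V N))
        Dp : d ≈ D p
        Dp = trans (-‿cong (*-congˡ (*-congˡ V-lambert))) (sym (D-P N))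

open import Data.Empty using (⊥; ⊥-elim)
open import Data.Fin using (Fin; toℕ)
import Data.Fin.Properties as Fin
open import Data.Integer.Divisibility using (_∣_)
import Data.Integer.Divisibility.Signed as Signed
open import Data.Nat using (_+_; _*_; _^_; _∸_; _/_; _%_; _≤_; NonZero)
import Data.Nat.DivMod as ℕ
import Data.Nat.Divisibility as ℕ
open import Data.Nat.Primality using (euclidsLemma; prime?)
open import Data.Sum as Sum using (_⊎_; inj₁; inj₂)
open import Relation.Binary.PropositionalEquality
  using (_≢_; _≗_; refl; sym; trans; cong; cong₂; subst; module ≡-Reasoning)
open import Relation.Nullary.Decidable using (from-yes; _→-dec_; _×-dec_; dec-false)
open import Defs

-- The ring of formal power series.

infixl 6 _⊕_
infix  8 ⊖_
infixr 7 _·_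

_⊕_ : PowerSeries → PowerSeries → PowerSeries
(a ⊕ b) n = a n ℤ.+ b n

⊖_ : PowerSeries → PowerSeries
(⊖ a) n = ℤ.- a n

_·_ : ℤ → PowerSeries → PowerSeries
(c · a) n = c ℤ.* a n

constant : ℤ → PowerSeries
constant c = c · (q^ 0)

-- Splitting off the first summand is a computation; it lets inductions on n recurse on the shifted
-- series `a ∘ suc`.
⊛-suc : ∀ a b n → (a ⊛ b) (suc n) ≡ a 0 ℤ.* b (suc n) ℤ.+ ((a ∘ suc) ⊛ b) n
⊛-suc a b n = refl

⊛-cong-≤ : ∀ n {a a′ b b′} → (∀ i → i ≤ n → a i ≡ a′ i) → (∀ i → i ≤ n → b i ≡ b′ i) →
           (a ⊛ b) n ≡ (a′ ⊛ b′) n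
⊛-cong-≤ zero    a≡ b≡ = cong (ℤ._+ 0ℤ) (cong₂ ℤ._*_ (a≡ 0 z≤n) (b≡ 0 z≤n))
⊛-cong-≤ (suc n) {a} {a′} {b} {b′} a≡ b≡ = begin
  (a ⊛ b) (suc n)                             ≡⟨ ⊛-suc a b n ⟩
  a 0 ℤ.* b (suc n) ℤ.+ ((a ∘ suc) ⊛ b) n     ≡⟨ cong₂ ℤ._+_
    (cong₂ ℤ._*_ (a≡ 0 z≤n) (b≡ (suc n) ℕ.≤-refl))
    (⊛-cong-≤ n (λ i i≤n → a≡ (suc i) (s≤s i≤n)) (λ i i≤n → b≡ i (ℕ.m≤n⇒m≤1+n i≤n))) ⟩
  a′ 0 ℤ.* b′ (suc n) ℤ.+ ((a′ ∘ suc) ⊛ b′) n ≡⟨ ⊛-suc a′ b′ n ⟨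
  (a′ ⊛ b′) (suc n)                           ∎
  where open ≡-Reasoning

⊛-distribʳ-⊕ : ∀ c a b → (a ⊕ b) ⊛ c ≗ (a ⊛ c) ⊕ (b ⊛ c)
⊛-distribʳ-⊕ c a b zero = lemma (a 0) (b 0) (c 0)
  where
  lemma : ∀ a b c → (a ℤ.+ b) ℤ.* c ℤ.+ 0ℤ ≡ a ℤ.* c ℤ.+ 0ℤ ℤ.+ (b ℤ.* c ℤ.+ 0ℤ)
  lemma = ℤRing.solve-∀
⊛-distribʳ-⊕ c a b (suc n) = trans
  (cong (λ u → (a 0 ℤ.+ b 0) ℤ.* c (suc n) ℤ.+ u) (⊛-distribʳ-⊕ c (a ∘ suc) (b ∘ suc) n))
  (lemma (a 0) (b 0) (c (suc n)) (((a ∘ suc) ⊛ c) n) (((b ∘ suc) ⊛ c) n))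
  where
  lemma : ∀ a b c s t → (a ℤ.+ b) ℤ.* c ℤ.+ (s ℤ.+ t) ≡ a ℤ.* c ℤ.+ s ℤ.+ (b ℤ.* c ℤ.+ t)
  lemma = ℤRing.solve-∀

·-⊛ : ∀ c a b → (c · a) ⊛ b ≗ c · (a ⊛ b)
·-⊛ c a b zero = lemma c (a 0) (b 0)
  where
  lemma : ∀ c a b → c ℤ.* a ℤ.* b ℤ.+ 0ℤ ≡ c ℤ.* (a ℤ.* b ℤ.+ 0ℤ)
  lemma = ℤRing.solve-∀
·-⊛ c a b (suc n) = trans
  (cong (λ u → c ℤ.* a 0 ℤ.* b (suc n) ℤ.+ u) (·-⊛ c (a ∘ suc) b n))
  (lemma c (a 0) (b (suc n)) (((a ∘ suc) ⊛ b) n))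
  where
  lemma : ∀ c a b s → c ℤ.* a ℤ.* b ℤ.+ c ℤ.* s ≡ c ℤ.* (a ℤ.* b ℤ.+ s)
  lemma = ℤRing.solve-∀

-- The mirror image of `⊛-suc`: commutativity follows by peeling the first summand on one side and
-- the last on the other.
⊛-suc-last : ∀ a b n → (a ⊛ b) (suc n) ≡ (a ⊛ (b ∘ suc)) n ℤ.+ a (suc n) ℤ.* b 0
⊛-suc-last a b zero = lemma (a 0 ℤ.* b 1) (a 1 ℤ.* b 0)
  where
  lemma : ∀ s t → s ℤ.+ (t ℤ.+ 0ℤ) ≡ s ℤ.+ 0ℤ ℤ.+ t
  lemma = ℤRing.solve-∀
⊛-suc-last a b (suc n) = trans
  (cong (λ u → a 0 ℤ.* b (suc (suc n)) ℤ.+ u) (⊛-suc-last (a ∘ suc) b n))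
  (sym (ℤ.+-assoc (a 0 ℤ.* b (suc (suc n))) (((a ∘ suc) ⊛ (b ∘ suc)) n) (a (suc (suc n)) ℤ.* b 0)))

⊛-comm : ∀ a b → a ⊛ b ≗ b ⊛ a
⊛-comm a b zero    = cong (ℤ._+ 0ℤ) (ℤ.*-comm (a 0) (b 0))
⊛-comm a b (suc n) = begin
  (a ⊛ b) (suc n)                          ≡⟨ ⊛-suc a b n ⟩
  a 0 ℤ.* b (suc n) ℤ.+ ((a ∘ suc) ⊛ b) n  ≡⟨ cong₂ ℤ._+_ (ℤ.*-comm (a 0) _) (⊛-comm (a ∘ suc) b n) ⟩
  b (suc n) ℤ.* a 0 ℤ.+ (b ⊛ (a ∘ suc)) n  ≡⟨ ℤ.+-comm (b (suc n) ℤ.* a 0) _ ⟩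
  (b ⊛ (a ∘ suc)) n ℤ.+ b (suc n) ℤ.* a 0  ≡⟨ ⊛-suc-last b a n ⟨
  (b ⊛ a) (suc n)                          ∎
  where open ≡-Reasoning

⊛-assoc : ∀ a b c → (a ⊛ b) ⊛ c ≗ a ⊛ (b ⊛ c)
⊛-assoc a b c zero = lemma (a 0) (b 0) (c 0)
  where
  lemma : ∀ a b c → (a ℤ.* b ℤ.+ 0ℤ) ℤ.* c ℤ.+ 0ℤ ≡ a ℤ.* (b ℤ.* c ℤ.+ 0ℤ) ℤ.+ 0ℤ
  lemma = ℤRing.solve-∀
⊛-assoc a b c (suc n) = begin
  ((a ⊛ b) ⊛ c) (suc n)
    ≡⟨ ⊛-suc (a ⊛ b) c n ⟩
  -- By computation `(a ⊛ b) ∘ suc` is this sum of a scaled shift and a product with a shift, to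
  -- which distributivity and the induction hypothesis apply.
  (a ⊛ b) 0 ℤ.* c (suc n) ℤ.+ ((a 0 · b ∘ suc ⊕ (a ∘ suc) ⊛ b) ⊛ c) n
    ≡⟨ cong (λ u → (a ⊛ b) 0 ℤ.* c (suc n) ℤ.+ u)
         (trans (⊛-distribʳ-⊕ c (a 0 · b ∘ suc) ((a ∘ suc) ⊛ b) n)
                (cong₂ ℤ._+_ (·-⊛ (a 0) (b ∘ suc) c n) (⊛-assoc (a ∘ suc) b c n))) ⟩
  (a 0 ℤ.* b 0 ℤ.+ 0ℤ) ℤ.* c (suc n) ℤ.+
    (a 0 ℤ.* ((b ∘ suc) ⊛ c) n ℤ.+ ((a ∘ suc) ⊛ (b ⊛ c)) n)
    ≡⟨ lemma (a 0) (b 0) (c (suc n)) (((b ∘ suc) ⊛ c) n) (((a ∘ suc) ⊛ (b ⊛ c)) n) ⟩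
  a 0 ℤ.* (b 0 ℤ.* c (suc n) ℤ.+ ((b ∘ suc) ⊛ c) n) ℤ.+ ((a ∘ suc) ⊛ (b ⊛ c)) n
    ≡⟨ ⊛-suc a (b ⊛ c) n ⟨
  (a ⊛ (b ⊛ c)) (suc n) ∎
  where
  open ≡-Reasoning
  lemma : ∀ a b c s t → (a ℤ.* b ℤ.+ 0ℤ) ℤ.* c ℤ.+ (a ℤ.* s ℤ.+ t) ≡ a ℤ.* (b ℤ.* c ℤ.+ s) ℤ.+ t
  lemma = ℤRing.solve-∀

⊛-identityʳ : ∀ a → a ⊛ q^ 0 ≗ a
⊛-identityʳ a n = ⊛-identityʳ-upTo a (q^ 0) n (λ _ _ → refl)

⊛-identityˡ : ∀ a → q^ 0 ⊛ a ≗ a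
⊛-identityˡ a n = trans (⊛-comm (q^ 0) a n) (⊛-identityʳ a n)

⊛-distribˡ-⊕ : ∀ c a b → c ⊛ (a ⊕ b) ≗ (c ⊛ a) ⊕ (c ⊛ b)
⊛-distribˡ-⊕ c a b n = trans (⊛-comm c (a ⊕ b) n)
  (trans (⊛-distribʳ-⊕ c a b n) (cong₂ ℤ._+_ (⊛-comm a c n) (⊛-comm b c n)))

constant-⊛ : ∀ c a → constant c ⊛ a ≗ c · a
constant-⊛ c a n = trans (·-⊛ c (q^ 0) a n) (cong (c ℤ.*_) (⊛-identityˡ a n))

⊛-vanishing : ∀ n a b → (∀ i → i ≤ n → a i ℤ.* b (n ∸ i) ≡ 0ℤ) → (a ⊛ b) n ≡ 0ℤ
⊛-vanishing zero    a b ab≡0 = cong (ℤ._+ 0ℤ) (ab≡0 0 z≤n)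
⊛-vanishing (suc n) a b ab≡0 = cong₂ ℤ._+_ (ab≡0 0 z≤n)
  (⊛-vanishing n (a ∘ suc) b (λ i i≤n → ab≡0 (suc i) (s≤s i≤n)))

-- ℤ[[q]] with coefficients compared only up to qᴺ, that is, ℤ[[q]]/(qᴺ⁺¹).
truncatedRing : ℕ → CommutativeRing _ _
truncatedRing N = record
  { Carrier = PowerSeries
  ; _≈_ = λ a b → ∀ n → n ≤ N → a n ≡ b n
  ; _+_ = _⊕_
  ; _*_ = _⊛_
  ; -_  = ⊖_
  ; 0#  = λ _ → 0ℤ
  ; 1#  = q^ 0
  ; isCommutativeRing = record
    { isRing = record
      { +-isAbelianGroup = record
        { isGroup = record
          { isMonoid = record
            { isSemigroup = record
              { isMagma = record
                { isEquivalence = record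
                  { refl  = λ n _ → refl
                  ; sym   = λ a≈b n n≤N → sym (a≈b n n≤N)
                  ; trans = λ a≈b b≈c n n≤N → trans (a≈b n n≤N) (b≈c n n≤N)
                  }
                ; ∙-cong = λ a≈ b≈ n n≤N → cong₂ ℤ._+_ (a≈ n n≤N) (b≈ n n≤N)
                }
              ; assoc = λ a b c n _ → ℤ.+-assoc (a n) (b n) (c n)
              }
            ; identity = (λ a n _ → ℤ.+-identityˡ (a n)) , (λ a n _ → ℤ.+-identityʳ (a n))
            }
          ; inverse = (λ a n _ → ℤ.+-inverseˡ (a n)) , (λ a n _ → ℤ.+-inverseʳ (a n))
          ; ⁻¹-cong = λ a≈ n n≤N → cong ℤ.-_ (a≈ n n≤N)
          }
        ; comm = λ a b n _ → ℤ.+-comm (a n) (b n)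
        }
      ; *-cong = λ a≈ b≈ n n≤N → ⊛-cong-≤ n
          (λ i i≤n → a≈ i (ℕ.≤-trans i≤n n≤N)) (λ i i≤n → b≈ i (ℕ.≤-trans i≤n n≤N))
      ; *-assoc    = λ a b c n _ → ⊛-assoc a b c n
      ; *-identity = (λ a n _ → ⊛-identityˡ a n) , (λ a n _ → ⊛-identityʳ a n)
      ; distrib    = (λ c a b n _ → ⊛-distribˡ-⊕ c a b n) , (λ c a b n _ → ⊛-distribʳ-⊕ c a b n)
      }
    ; *-comm = λ a b n _ → ⊛-comm a b n
    }
  }

constant-morphism : ∀ N → ℤ.+-*-rawRing -Raw-AlmostCommutative⟶ fromCommutativeRing (truncatedRing N)
constant-morphism N = record
  { ⟦_⟧    = constant
  ; +-homo = λ a b n _ → ℤ.*-distribʳ-+ ((q^ 0) n) a b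
  ; *-homo = λ a b n _ → trans (ℤ.*-assoc a b ((q^ 0) n)) (sym (constant-⊛ a (constant b) n))
  ; -‿homo = λ a n _ → sym (ℤ.neg-distribˡ-* a ((q^ 0) n))
  ; 0-homo = λ n _ → ℤ.*-zeroˡ ((q^ 0) n)
  ; 1-homo = λ n _ → ℤ.*-identityˡ ((q^ 0) n)
  }

-- Monomials and the derivation q d/dq.

q^-≢ : ∀ {m n} → m ≢ n → (q^ m) n ≡ 0ℤ
q^-≢ {m} {n} m≢n rewrite dec-false (m ℕ.≟ n) m≢n = refl

q^-+ : ∀ m n → q^ (m + n) ≗ q^ m ⊛ q^ n
q^-+ zero    n j       = sym (⊛-identityˡ (q^ n) j)
q^-+ (suc m) n zero    = sym (trans (ℤ.+-identityʳ _) (ℤ.*-zeroˡ ((q^ n) 0)))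
q^-+ (suc m) n (suc j) = trans (q^-+ m n j)
  (sym (trans (cong (ℤ._+ (q^ m ⊛ q^ n) j) (ℤ.*-zeroˡ ((q^ n) (suc j)))) (ℤ.+-identityˡ _)))

-- q d/dq
θ : PowerSeries → PowerSeries
θ a n = + n ℤ.* a n

θ-⊛ : ∀ a b → θ (a ⊛ b) ≗ (θ a ⊛ b) ⊕ (a ⊛ θ b)
θ-⊛ a b = shifted a 0
  where
  -- Each peeling of `a` lowers its indices by one; the offset s records how many were peeled, so
  -- that the original weights survive the induction.
  θ[_] : ℕ → PowerSeries → PowerSeries
  θ[ s ] a n = + (s + n) ℤ.* a n
  shifted : ∀ a s n → + (s + n) ℤ.* (a ⊛ b) n ≡ (θ[ s ] a ⊛ b) n ℤ.+ (a ⊛ θ b) n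
  shifted a s zero = lemma (+ (s + 0)) (a 0) (b 0)
    where
    lemma : ∀ s a b → s ℤ.* (a ℤ.* b ℤ.+ 0ℤ) ≡ s ℤ.* a ℤ.* b ℤ.+ 0ℤ ℤ.+ (a ℤ.* (0ℤ ℤ.* b) ℤ.+ 0ℤ)
    lemma = ℤRing.solve-∀
  shifted a s (suc n) = begin
    + (s + suc n) ℤ.* (a 0 ℤ.* b (suc n) ℤ.+ t)
      ≡⟨ ℤ.*-distribˡ-+ (+ (s + suc n)) (a 0 ℤ.* b (suc n)) t ⟩
    + (s + suc n) ℤ.* (a 0 ℤ.* b (suc n)) ℤ.+ + (s + suc n) ℤ.* t
      ≡⟨ cong₂ ℤ._+_ (cong (ℤ._* (a 0 ℤ.* b (suc n))) (ℤ.pos-+ s (suc n)))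
           (trans (cong (λ m → + m ℤ.* t) (ℕ.+-suc s n)) (shifted (a ∘ suc) (suc s) n)) ⟩
    (+ s ℤ.+ + suc n) ℤ.* (a 0 ℤ.* b (suc n)) ℤ.+ ((θ[ suc s ] (a ∘ suc) ⊛ b) n ℤ.+ ((a ∘ suc) ⊛ θ b) n)
      ≡⟨ lemma (+ s) (+ suc n) (a 0) (b (suc n)) ((θ[ suc s ] (a ∘ suc) ⊛ b) n) (((a ∘ suc) ⊛ θ b) n) ⟩
    + s ℤ.* a 0 ℤ.* b (suc n) ℤ.+ (θ[ suc s ] (a ∘ suc) ⊛ b) n ℤ.+ (a ⊛ θ b) (suc n)
      ≡⟨ cong (ℤ._+ (a ⊛ θ b) (suc n)) (cong₂ ℤ._+_
           (cong (λ m → + m ℤ.* a 0 ℤ.* b (suc n)) (sym (ℕ.+-identityʳ s)))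
           (⊛-cong-≤ n {b = b} (λ i _ → cong (λ m → + m ℤ.* a (suc i)) (sym (ℕ.+-suc s i))) (λ _ _ → refl))) ⟩
    (θ[ s ] a ⊛ b) (suc n) ℤ.+ (a ⊛ θ b) (suc n) ∎
    where
    open ≡-Reasoning
    t = ((a ∘ suc) ⊛ b) n
    lemma : ∀ s m a b u v → (s ℤ.+ m) ℤ.* (a ℤ.* b) ℤ.+ (u ℤ.+ v) ≡
                            s ℤ.* a ℤ.* b ℤ.+ u ℤ.+ (a ℤ.* (m ℤ.* b) ℤ.+ v)
    lemma = ℤRing.solve-∀

θ-q^ : ∀ m → θ (q^ m) ≗ (+ m) · (q^ m)
θ-q^ m n with m ℕ.≟ n
... | yes refl = refl
... | no  m≢n rewrite q^-≢ m≢n = trans (ℤ.*-zeroʳ (+ n)) (sym (ℤ.*-zeroʳ (+ m)))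

-- Specialisation to x = q².

module EvenTruncation (N : ℕ) where

  open CommutativeRing (truncatedRing N) using (_≈_; *-cong) renaming (trans to ≈-trans; sym to ≈-sym)

  q²^_ : ℕ → PowerSeries
  q²^ i = q^ (2 * i)

  q²^0 : q²^ 0 ≈ constant 1ℤ
  q²^0 n _ = sym (ℤ.*-identityˡ ((q^ 0) n))

  q²^-+ : ∀ m n → q²^ (m + n) ≈ q²^ m ⊛ q²^ n
  q²^-+ m n j _ = trans (cong (λ e → (q^ e) j) (ℕ.*-distribˡ-+ 2 m n)) (q^-+ (2 * m) (2 * n) j)

  q²^-nilpotent : ∀ n → N < n → q²^ n ≈ constant 0ℤ
  q²^-nilpotent n N<n j j≤N = q^-≢ λ 2n≡j → ℕ.<⇒≱ N<n
    (ℕ.≤-trans (ℕ.m≤n*m n 2) (ℕ.≤-trans (ℕ.≤-reflexive 2n≡j) j≤N))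

  open RingIdentities (truncatedRing N) (constant-morphism N)
  open NilpotentProducts N q²^_ q²^0 q²^-+ q²^-nilpotent
    public using (P; R₂; pent; ε; factor; P≈pent; quotient-mod16)

  1-q^≈factor : ∀ i → 1-q^ (2 * i) ≈ factor i
  1-q^≈factor i n _ = cong (ℤ._- (q²^ i) n) (sym (ℤ.*-identityˡ ((q^ 0) n)))

  partialProduct≈P : ∀ n → partialProduct 2 n ≈ P n
  partialProduct≈P zero    j _ = sym (ℤ.*-identityˡ ((q^ 0) j))
  partialProduct≈P (suc n) = *-cong (partialProduct≈P n) (1-q^≈factor (suc n))

  partialProduct≈R₂ : ∀ n → partialProduct 4 n ≈ R₂ n
  partialProduct≈R₂ zero    j _ = sym (ℤ.*-identityˡ ((q^ 0) j))
  partialProduct≈R₂ (suc n) = *-cong (partialProduct≈R₂ n) λ j j≤N → trans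
    (cong (λ e → (1-q^ e) j) (ℕ.*-assoc 2 2 (suc n)))
    (1-q^≈factor (2 * suc n) j j≤N)

  -- Coefficient n of `f k` uses n factors, and by `f-limit` the further `N ∸ n` factors do not
  -- change it; so one finite product serves all degrees up to `N`.
  f≈partialProduct : ∀ k .{{_ : NonZero k}} → f k ≈ partialProduct k N
  f≈partialProduct k n n≤N = trans (sym (f-limit k n (N ∸ n)))
    (cong (λ M → partialProduct k M n) (ℕ.m∸n+n≡m n≤N))

  f₂≈P : f 2 ≈ P N
  f₂≈P = ≈-trans (f≈partialProduct 2) (partialProduct≈P N)

  f₄≈R₂ : f 4 ≈ R₂ N
  f₄≈R₂ = ≈-trans (f≈partialProduct 4) (partialProduct≈R₂ N)

  θ-factor : ∀ i → θ (factor i) ≈ ⊖ (constant (+ 2) ⊛ (constant (+ i) ⊛ q²^ i))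
  θ-factor i n _ = begin
    + n ℤ.* (1ℤ ℤ.* (q^ 0) n ℤ.- (q²^ i) n)
      ≡⟨ lemma (+ n) ((q^ 0) n) ((q²^ i) n) ⟩
    θ (q^ 0) n ℤ.- θ (q²^ i) n
      ≡⟨ cong₂ ℤ._-_ (trans (θ-q^ 0 n) (ℤ.*-zeroˡ ((q^ 0) n))) (θ-q^ (2 * i) n) ⟩
    0ℤ ℤ.- + (2 * i) ℤ.* (q²^ i) n
      ≡⟨ ℤ.+-identityˡ _ ⟩
    ℤ.- (+ (2 * i) ℤ.* (q²^ i) n)
      ≡⟨ cong ℤ.-_ (begin
           + (2 * i) ℤ.* (q²^ i) n          ≡⟨ cong (ℤ._* (q²^ i) n) (ℤ.pos-* 2 i) ⟩
           + 2 ℤ.* + i ℤ.* (q²^ i) n        ≡⟨ ℤ.*-assoc (+ 2) (+ i) _ ⟩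
           + 2 ℤ.* (+ i ℤ.* (q²^ i) n)      ≡⟨ cong (+ 2 ℤ.*_) (constant-⊛ (+ i) (q²^ i) n) ⟨
           + 2 ℤ.* (constant (+ i) ⊛ q²^ i) n
                                            ≡⟨ constant-⊛ (+ 2) (constant (+ i) ⊛ q²^ i) n ⟨
           (constant (+ 2) ⊛ (constant (+ i) ⊛ q²^ i)) n ∎) ⟩
    ℤ.- (constant (+ 2) ⊛ (constant (+ i) ⊛ q²^ i)) n ∎
    where
    open ≡-Reasoning
    lemma : ∀ n u v → n ℤ.* (1ℤ ℤ.* u ℤ.- v) ≡ n ℤ.* u ℤ.- n ℤ.* v
    lemma = ℤRing.solve-∀

  θ-1 : θ (constant 1ℤ) ≈ constant 0ℤ
  θ-1 n _ = trans (cong (+ n ℤ.*_) (ℤ.*-identityˡ ((q^ 0) n))) (θ-q^ 0 n)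

  EOᵤ*P² : EOᵤ ⊛ P N ² ≈ R₂ N ²
  EOᵤ*P² n n≤N = begin
    (EOᵤ ⊛ P N ²) n   ≡⟨ ⊛-cong-≤ n {EOᵤ} {EOᵤ} {P N ²} {f 2 ²} (λ _ _ → refl)
                           (λ i i≤n → sym (f₂²≈ i (ℕ.≤-trans i≤n n≤N))) ⟩
    (EOᵤ ⊛ f 2 ²) n   ≡⟨ EOᵤ-generatingFunction n ⟩
    (f 4 ²) n         ≡⟨ *-cong {f 4} {R₂ N} {f 4} {R₂ N} f₄≈R₂ f₄≈R₂ n n≤N ⟩
    (R₂ N ²) n        ∎
    where
    open ≡-Reasoning
    f₂²≈ : f 2 ² ≈ P N ²
    f₂²≈ = *-cong {f 2} {P N} {f 2} {P N} f₂≈P f₂≈P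

  EOᵤ≈ : ∃[ c ] EOᵤ ≈ P N ² ⊕ ⊖ θ (P N ²) ⊕ constant (+ 16) ⊛ c
  EOᵤ≈ = quotient-mod16 θ (λ a b n _ → θ-⊛ a b n) θ-1 θ-factor EOᵤ EOᵤ*P²

  -- The truncation degree is the index of interest, so the top coefficient of the truncated
  -- congruence is the one to read off.
  EOᵤ-mod16 : ∃[ c ] EOᵤ N ≡ (P N ²) N ℤ.- + N ℤ.* (P N ²) N ℤ.+ + 16 ℤ.* c
  EOᵤ-mod16 = let c , eq = EOᵤ≈ in c N , (begin
    EOᵤ N
      ≡⟨ eq N ℕ.≤-refl ⟩
    (P N ²) N ℤ.- + N ℤ.* (P N ²) N ℤ.+ (constant (+ 16) ⊛ c) N
      ≡⟨ cong (λ u → (P N ²) N ℤ.- + N ℤ.* (P N ²) N ℤ.+ u) (constant-⊛ (+ 16) c N) ⟩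
    (P N ²) N ℤ.- + N ℤ.* (P N ²) N ℤ.+ + 16 ℤ.* c N ∎)
    where open ≡-Reasoning

-- Support of the pentagonal series and of its square.

IsSquare : ℕ → Set
IsSquare n = ∃[ m ] n ≡ m * m

-- In powers of q the pentagonal exponents are i = m(3m ± 1), and completing the square gives 12i +
-- 1 = (6m ± 1)².
PentagonallySupported : PowerSeries → Set
PentagonallySupported a = ∀ i → a i ≡ 0ℤ ⊎ IsSquare (12 * i + 1)

⊕-supported : ∀ a b → PentagonallySupported a → PentagonallySupported b → PentagonallySupported (a ⊕ b)
⊕-supported a b sa sb i with sa i | sb i
... | inj₂ sq | _       = inj₂ sq
... | inj₁ _  | inj₂ sq = inj₂ sq
... | inj₁ a₀ | inj₁ b₀ = inj₁ (cong₂ ℤ._+_ a₀ b₀)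

·-supported : ∀ c a → PentagonallySupported a → PentagonallySupported (c · a)
·-supported c a sa i with sa i
... | inj₁ a₀ = inj₁ (trans (cong (c ℤ.*_) a₀) (ℤ.*-zeroʳ c))
... | inj₂ sq = inj₂ sq

q^-supported : ∀ m → IsSquare (12 * m + 1) → PentagonallySupported (q^ m)
q^-supported m sq i with m ℕ.≟ i
... | yes refl = inj₂ sq
... | no  m≢i  = inj₁ (q^-≢ m≢i)

≗-supported : ∀ {a b} → a ≗ b → PentagonallySupported b → PentagonallySupported a
≗-supported a≗b sb i = Sum.map₁ (trans (a≗b i)) (sb i)

2*tri : ∀ n → 2 * tri n ≡ n * suc n
2*tri zero    = refl
2*tri (suc n) = begin
  2 * (tri n + suc n)        ≡⟨ ℕ.*-distribˡ-+ 2 (tri n) (suc n) ⟩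
  2 * tri n + 2 * suc n    ≡⟨ cong (_+ 2 * suc n) (2*tri n) ⟩
  n * suc n + 2 * suc n    ≡⟨ lemma n ⟩
  suc n * suc (suc n)          ∎
  where
  open ≡-Reasoning
  lemma : ∀ n → n * suc n + 2 * suc n ≡ suc n * suc (suc n)
  lemma = ℕRing.solve-∀

pentagonal-square₁ : ∀ n → IsSquare (12 * (2 * (suc n * suc n + tri n)) + 1)
-- The root is 6m - 1 for m = n + 1.
pentagonal-square₁ n = 6 * n + 5 ,
  trans (isolate n (tri n)) (trans (cong (λ t → 24 * (suc n * suc n) + 12 * t + 1) (2*tri n)) (square n))
  where
  isolate : ∀ n t → 12 * (2 * (suc n * suc n + t)) + 1 ≡
                    24 * (suc n * suc n) + 12 * (2 * t) + 1
  isolate = ℕRing.solve-∀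
  square : ∀ n → 24 * (suc n * suc n) + 12 * (n * suc n) + 1 ≡
                 (6 * n + 5) * (6 * n + 5)
  square = ℕRing.solve-∀

pentagonal-square₂ : ∀ m → IsSquare (12 * (2 * (m * m + tri m)) + 1)
pentagonal-square₂ m = 6 * m + 1 ,
  trans (isolate m (tri m)) (trans (cong (λ t → 24 * (m * m) + 12 * t + 1) (2*tri m)) (square m))
  where
  isolate : ∀ m t → 12 * (2 * (m * m + t)) + 1 ≡ 24 * (m * m) + 12 * (2 * t) + 1
  isolate = ℕRing.solve-∀
  square : ∀ m → 24 * (m * m) + 12 * (m * suc m) + 1 ≡ (6 * m + 1) * (6 * m + 1)
  square = ℕRing.solve-∀

module _ (N : ℕ) where
  open EvenTruncation N

  -- A constant factor only scales coefficients and cannot move exponents, so the signs preserve the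
  -- support.
  ε-constant : ∀ n → ∃[ s ] ε n ≗ constant s
  ε-constant zero = 1ℤ , λ _ → refl
  ε-constant (suc n) with ε-constant n
  ... | s , ε≗ = ℤ.- s , λ j → trans (cong ℤ.-_ (ε≗ j)) (ℤ.neg-distribˡ-* s ((q^ 0) j))

  ε-supported : ∀ n a → PentagonallySupported a → PentagonallySupported (ε n ⊛ a)
  ε-supported n a sa with ε-constant n
  ... | s , ε≗ = ≗-supported {b = s · a}
    (λ j → trans (⊛-cong-≤ j {b = a} (λ i _ → ε≗ i) (λ _ _ → refl)) (constant-⊛ s a j)) (·-supported s a sa)

  pent-supported : ∀ n → PentagonallySupported (pent n)
  pent-supported zero    = ·-supported 1ℤ (q^ 0) (q^-supported 0 (1 , refl))
  pent-supported (suc n) = ⊕-supported (pent n) (ε (suc n) ⊛ (q²^ e₁ ⊕ q²^ e₂)) (pent-supported n)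
    (ε-supported (suc n) (q²^ e₁ ⊕ q²^ e₂) (⊕-supported (q²^ e₁) (q²^ e₂)
      (q^-supported (2 * e₁) (pentagonal-square₁ n)) (q^-supported (2 * e₂) (pentagonal-square₂ (suc n)))))
    where
    e₁ e₂ : ℕ
    e₁ = suc n * suc n + tri n
    e₂ = suc n * suc n + tri (suc n)

  -- A nonzero product of the coefficients at i and `N ∸ i` would make 12i + 1 and 12(N - i) + 1
  -- squares, and these add up to 12N + 2.
  P²-vanishing : (∀ X Y → 12 * N + 2 ≢ X * X + Y * Y) → (P N ²) N ≡ 0ℤ
  P²-vanishing not-sum = trans (⊛-cong-≤ N P≈pent P≈pent) (⊛-vanishing N (pent N) (pent N) summand≡0)
    where
    summand≡0 : ∀ i → i ≤ N → pent N i ℤ.* pent N (N ∸ i) ≡ 0ℤ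
    summand≡0 i i≤N with pent-supported N i | pent-supported N (N ∸ i)
    ... | inj₁ a₀ | _       = cong (ℤ._* pent N (N ∸ i)) a₀
    ... | inj₂ _  | inj₁ b₀ = trans (cong (pent N i ℤ.*_) b₀) (ℤ.*-zeroʳ (pent N i))
    ... | inj₂ (X , X²≡) | inj₂ (Y , Y²≡) = ⊥-elim (not-sum X Y (begin
      12 * N + 2
        ≡⟨ cong (λ M → 12 * M + 2) (ℕ.m+[n∸m]≡n i≤N) ⟨
      12 * (i + (N ∸ i)) + 2
        ≡⟨ lemma i (N ∸ i) ⟩
      (12 * i + 1) + (12 * (N ∸ i) + 1)
        ≡⟨ cong₂ _+_ X²≡ Y²≡ ⟩
      X * X + Y * Y ∎))
      where
      open ≡-Reasoning
      lemma : ∀ i j → 12 * (i + j) + 2 ≡ (12 * i + 1) + (12 * j + 1)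
      lemma = ℕRing.solve-∀

  16∣EOᵤ : (∀ X Y → 12 * N + 2 ≢ X * X + Y * Y) → + 16 ∣ EOᵤ N
  16∣EOᵤ not-sum = let c , EOᵤ≡ = EOᵤ-mod16 in Signed.∣⇒∣ᵤ (Signed.divides c (begin
    EOᵤ N                                            ≡⟨ EOᵤ≡ ⟩
    (P N ²) N ℤ.- + N ℤ.* (P N ²) N ℤ.+ + 16 ℤ.* c   ≡⟨ cong (λ p → p ℤ.- + N ℤ.* p ℤ.+ + 16 ℤ.* c)
                                                          (P²-vanishing not-sum) ⟩
    0ℤ ℤ.- + N ℤ.* 0ℤ ℤ.+ + 16 ℤ.* c                 ≡⟨ lemma (+ N) c ⟩
    c ℤ.* + 16                                       ∎))
    where
    open ≡-Reasoning
    lemma : ∀ n c → 0ℤ ℤ.- n ℤ.* 0ℤ ℤ.+ + 16 ℤ.* c ≡ c ℤ.* + 16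
    lemma = ℤRing.solve-∀

-- Sums of two squares and the prime 7.

-- It holds because -1 is not a square modulo 7; the 49 pairs of residues are checked by decision.
squares-mod7 : ∀ (a b : Fin 7) → (toℕ a * toℕ a + toℕ b * toℕ b) % 7 ≡ 0 → toℕ a ≡ 0 × toℕ b ≡ 0
squares-mod7 = from-yes (Fin.all? λ (a : Fin 7) → Fin.all? λ (b : Fin 7) →
  ((toℕ a * toℕ a + toℕ b * toℕ b) % 7 ℕ.≟ 0) →-dec ((toℕ a ℕ.≟ 0) ×-dec (toℕ b ℕ.≟ 0)))

7∣X²+Y² : ∀ X Y → 7 ℕ.∣ X * X + Y * Y → 7 ℕ.∣ X × 7 ℕ.∣ Y
7∣X²+Y² X Y 7∣ with squares-mod7 (X ℕ.mod 7) (Y ℕ.mod 7) residues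
  where
  open ≡-Reasoning
  toℕ-mod : ∀ Z → toℕ (Z ℕ.mod 7) ≡ Z % 7
  toℕ-mod Z = Fin.toℕ-fromℕ< (ℕ.m%n<n Z 7)
  square-mod : ∀ Z → (Z % 7 * (Z % 7)) % 7 ≡ (Z * Z) % 7
  square-mod Z = sym (ℕ.%-distribˡ-* Z Z 7)
  residues : (toℕ (X ℕ.mod 7) * toℕ (X ℕ.mod 7) + toℕ (Y ℕ.mod 7) * toℕ (Y ℕ.mod 7)) % 7 ≡ 0
  residues rewrite toℕ-mod X | toℕ-mod Y = begin
    (X % 7 * (X % 7) + Y % 7 * (Y % 7)) % 7
      ≡⟨ ℕ.%-distribˡ-+ (X % 7 * (X % 7)) _ 7 ⟩
    ((X % 7 * (X % 7)) % 7 + (Y % 7 * (Y % 7)) % 7) % 7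
      ≡⟨ cong₂ (λ s t → (s + t) % 7) (square-mod X) (square-mod Y) ⟩
    ((X * X) % 7 + (Y * Y) % 7) % 7
      ≡⟨ ℕ.%-distribˡ-+ (X * X) _ 7 ⟨
    (X * X + Y * Y) % 7
      ≡⟨ ℕ.n∣m⇒m%n≡0 _ 7 7∣ ⟩
    0 ∎
... | X≡0 , Y≡0 = divides-by X X≡0 , divides-by Y Y≡0
  where
  divides-by : ∀ Z → toℕ (Z ℕ.mod 7) ≡ 0 → 7 ℕ.∣ Z
  divides-by Z Z≡0 = ℕ.m%n≡0⇒n∣m Z 7 (trans (sym (Fin.toℕ-fromℕ< (ℕ.m%n<n Z 7))) Z≡0)

-- 7 is inert in ℤ[i], so it divides every norm to an even power.
not-sum-of-squares : ∀ k {d} → ¬ 7 ℕ.∣ d → ∀ X Y → 7 ^ (2 * k + 1) * d ≢ X * X + Y * Y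
not-sum-of-squares k {d} 7∤d X Y eq with 7∣X²+Y² X Y (subst (7 ℕ.∣_) eq 7∣lhs)
  where
  7∣lhs : 7 ℕ.∣ 7 ^ (2 * k + 1) * d
  7∣lhs = subst (λ e → 7 ℕ.∣ 7 ^ e * d) (ℕ.+-comm 1 (2 * k))
    (ℕ.∣m⇒∣m*n d (ℕ.m∣m*n (7 ^ (2 * k))))
... | ℕ.divides x refl , ℕ.divides y refl = descend k eq
  where
  49S : ∀ x y → x * 7 * (x * 7) + y * 7 * (y * 7) ≡ 7 * (7 * (x * x + y * y))
  49S = ℕRing.solve-∀
  -- With both roots divisible by 7, the right side has a factor 49. Cancelling it lowers the odd
  -- exponent by two; at exponent 1 the second 7 would have to divide `d`.
  descend : ∀ k → 7 ^ (2 * k + 1) * d ≡ x * 7 * (x * 7) + y * 7 * (y * 7) → ⊥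
  descend zero eq = 7∤d (subst (7 ℕ.∣_)
    (sym (ℕ.*-cancelˡ-≡ d (7 * (x * x + y * y)) 7 (trans eq (49S x y)))) (ℕ.m∣m*n (x * x + y * y)))
  descend (suc k) eq = not-sum-of-squares k 7∤d x y
    (ℕ.*-cancelˡ-≡ _ _ 7 (ℕ.*-cancelˡ-≡ _ _ 7 (trans (sym 7^≡) (trans eq (49S x y)))))
    where
    t = 7 ^ (2 * k + 1)
    7^≡ : 7 ^ (2 * suc k + 1) * d ≡ 7 * (7 * (7 ^ (2 * k + 1) * d))
    7^≡ = trans (cong (λ e → 7 ^ (e + 1) * d) (ℕ.*-suc 2 k))
      (trans (ℕ.*-assoc 7 (7 * t) d) (cong (7 ℕ.*_) (ℕ.*-assoc 7 t d)))

-- Arithmetic of the index.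

-- Since 7 ≡ 1 modulo 6, the division by 6 in the index is exact.
7^≡1+6* : ∀ m → ∃[ s ] 7 ^ m ≡ 1 + 6 * s
7^≡1+6* zero = 0 , refl
7^≡1+6* (suc m) with 7^≡1+6* m
... | s , eq = 1 + 7 * s , trans (cong (7 ℕ.*_) eq) (lemma s)
  where
  lemma : ∀ s → 7 * (1 + 6 * s) ≡ 1 + 6 * (1 + 7 * s)
  lemma = ℕRing.solve-∀

index : ℕ → ℕ → ℕ → ℕ
index n k r = 2 * 7 ^ (2 * k + 2) * n + 2 * 7 ^ (2 * k + 1) * r
                + (7 ^ (2 * k + 2) ∸ 1) / 6

-- The constant part of the index contributes 2(7²ᵏ⁺² - 1), and the added 2 completes it to 2 ·
-- 7²ᵏ⁺², so that all summands share the factor 7²ᵏ⁺¹. Splitting 24r as 21r + 3r exposes the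
-- cofactor's residue 3r modulo 7.
12*index+2 : ∀ n k r → 12 * index n k r + 2 ≡
  7 ^ (2 * k + 1) * (7 * (24 * n + 3 * r + 2) + 3 * r)
12*index+2 n k r with 7^≡1+6* (2 * k + 2)
... | s , 7^≡ = begin
  12 * (2 * T * n + 2 * t * r + (T ∸ 1) / 6) + 2
    ≡⟨ cong (λ u → 12 * (2 * T * n + 2 * t * r + u) + 2) quotient≡s ⟩
  12 * (2 * T * n + 2 * t * r + s) + 2
    ≡⟨ expand T t n r s ⟩
  24 * T * n + 24 * t * r + 2 * (1 + 6 * s)
    ≡⟨ cong₂ (λ u v → 24 * u * n + 24 * t * r + 2 * v) T≡7t (trans (sym 7^≡) T≡7t) ⟩
  24 * (7 * t) * n + 24 * t * r + 2 * (7 * t)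
    ≡⟨ collect t n r ⟩
  t * (7 * (24 * n + 3 * r + 2) + 3 * r) ∎
  where
  open ≡-Reasoning
  T = 7 ^ (2 * k + 2)
  t = 7 ^ (2 * k + 1)
  expand : ∀ T t n r s → 12 * (2 * T * n + 2 * t * r + s) + 2 ≡
    24 * T * n + 24 * t * r + 2 * (1 + 6 * s)
  expand = ℕRing.solve-∀
  collect : ∀ t n r → 24 * (7 * t) * n + 24 * t * r + 2 * (7 * t) ≡
    t * (7 * (24 * n + 3 * r + 2) + 3 * r)
  collect = ℕRing.solve-∀
  T≡7t : T ≡ 7 * t
  T≡7t = cong (7 ^_) (ℕ.+-suc (2 * k) 1)
  quotient≡s : (T ∸ 1) / 6 ≡ s
  quotient≡s = trans (cong (λ u → (u ∸ 1) / 6) 7^≡)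
    (trans (cong (_/ 6) (ℕ.*-comm 6 s)) (ℕ.m*n/n≡m s 6))

-- By primality 7 would divide 3 or r, and both are positive and below 7.
7∤cofactor : ∀ m r → 1 ≤ r → r ≤ 6 → ¬ 7 ℕ.∣ 7 * m + 3 * r
7∤cofactor m r@(suc _) _ r≤6 7∣ with euclidsLemma 3 r (from-yes (prime? 7)) (ℕ.∣m+n∣m⇒∣n 7∣ (ℕ.m∣m*n m))
... | inj₁ 7∣3 = ℕ.>⇒∤ (ℕ.m≤m+n 4 3) 7∣3
... | inj₂ 7∣r = ℕ.>⇒∤ (s≤s r≤6) 7∣r

corollary5p1 : ∀ (n k r : ℕ) → 1 ≤ r → r ≤ 6 →
    (+ 16) ∣ EOᵤ (2 * 7 ^ (2 * k + 2) * n + 2 * 7 ^ (2 * k + 1) * r + (7 ^ (2 * k + 2) ∸ 1) / 6)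
corollary5p1 n k r 1≤r r≤6 = 16∣EOᵤ (index n k r) λ X Y sum →
  not-sum-of-squares k (7∤cofactor (24 * n + 3 * r + 2) r 1≤r r≤6) X Y (trans (sym (12*index+2 n k r)) sum)
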